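{- There exists a $3$-edge-connected digraph $D=(V,A)$ with $|V|=122$ such that for every even subgraph $E\subseteq A$ the digraph $D/E$ is not strongly connected.
   Context: A digraph $D=(V,A)$ is $3$-edge-connected if its underlying undirected graph is. An even subgraph of $D$ is a subset $E\subseteq A$ that is an edge-disjoint union of cycles of the underlying undirected graph (the cycles are not necessarily directed; $E$ may be empty); equivalently, every vertex is incident with an even number of arcs of $E$. For $E\subseteq A$, $D/E$ denotes the digraph obtained from $D$ by contracting all arcs of $E$. (The proposition says that there is a counterexample on $122$ vertices to Hochstättler's conjecture, which asserts that every $3$-edge-connected digraph $D$ has an even subgraph $E$ such that $D/E$ is strongly connected.) -}

module Defs where

open import Data.Nat.Base using (ℕ; _<_)
open import Data.Fin.Base using (Fin)
open import Data.Fin.Subset using (Subset; _∈_; _∉_; ∣_∣)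
open import Data.List.Base using (List; []; _∷_)
import Data.List.Membership.Propositional as List
open import Data.List.Relation.Binary.Disjoint.Propositional using (Disjoint)
open import Data.List.Relation.Unary.AllPairs using (AllPairs)
open import Data.List.Relation.Unary.Any using (Any)
open import Data.List.Relation.Unary.Unique.Propositional using (Unique)
open import Data.Product using (Σ; Σ-syntax; ∃-syntax; _×_; _,_; proj₁; proj₂)
open import Data.Sum.Base using (_⊎_)
open import Function.Bundles using (_⇔_)
open import Function.Definitions using (Injective)
open import Level using (0ℓ)
open import Relation.Binary.Bundles using (Setoid)
open import Relation.Binary.Core using (Rel)
import Relation.Binary.Construct.Closure.Equivalence as Eq
open import Relation.Binary.Construct.Closure.ReflexiveTransitive using (Star)
open import Relation.Binary.PropositionalEquality using (_≡_; _≢_)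

-- A finite digraph (V , A) with V = Fin n and A a set of ordered pairs of
-- distinct vertices, listed without repetition as ends 0, …, ends (size - 1).
-- Antiparallel arcs are allowed, and give two parallel edges of the
-- underlying undirected graph.
record Digraph (n : ℕ) : Set where
  field
    size           : ℕ
    ends           : Fin size → Fin n × Fin n
    ends-injective : Injective _≡_ _≡_ ends
    loopless       : ∀ a → proj₁ (ends a) ≢ proj₂ (ends a)

  Arc : Set
  Arc = Fin size

  src tgt : Arc → Fin n
  src a = proj₁ (ends a)
  tgt a = proj₂ (ends a)

-- Contraction can create loops and parallel arcs and identifies vertices, so
-- its result is a multidigraph whose vertices form a setoid.
record Multidigraph : Set₁ where
  field
    vertices : Setoid 0ℓ 0ℓ
  open Setoid vertices public renaming (Carrier to Vertex)
  field
    Arc     : Set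
    src tgt : Arc → Vertex

StronglyConnected : Multidigraph → Set
StronglyConnected D = ∀ u v → Star Step u v
  where
  open Multidigraph D
  Step : Rel Vertex 0ℓ
  Step u v = u ≈ v ⊎ (∃[ a ] (u ≈ src a × tgt a ≈ v))

module _ {n : ℕ} (D : Digraph n) where
  open Digraph D

  ArcIn : (Arc → Set) → Rel (Fin n) 0ℓ
  ArcIn P u v = ∃[ a ] (P a × src a ≡ u × tgt a ≡ v)

  -- Joined by a path of the underlying undirected graph with all edges in P.
  Linked : (Arc → Set) → Rel (Fin n) 0ℓ
  Linked P = Eq.EqClosure (ArcIn P)

  EdgeConnected : ℕ → Set
  EdgeConnected k =
    1 < n × (∀ (F : Subset size) → ∣ F ∣ < k → ∀ u v → Linked (_∉ F) u v)

  Joins : Arc → Fin n → Fin n → Set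
  Joins a u v = (src a ≡ u × tgt a ≡ v) ⊎ (src a ≡ v × tgt a ≡ u)

  -- Walks of the underlying undirected graph.
  data Walk : Fin n → Fin n → Set where
    []   : ∀ {u} → Walk u u
    step : ∀ {u v w} (a : Arc) → Joins a u v → Walk v w → Walk u w

  arcs : ∀ {u v} → Walk u v → List Arc
  arcs []           = []
  arcs (step a _ p) = a ∷ arcs p

  -- The vertices of a walk other than its first one, in order, so that each
  -- vertex visited by a closed walk is listed once per visit.
  visits : ∀ {u v} → Walk u v → List (Fin n)
  visits []                   = []
  visits (step {v = v} _ _ p) = v ∷ visits p

  record Cycle : Set where
    field
      base              : Fin n
      walk              : Walk base base
      nonempty          : arcs walk ≢ []
      distinct-arcs     : Unique (arcs walk)
      distinct-vertices : Unique (visits walk)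

    cycleArcs : List Arc
    cycleArcs = arcs walk

  open Cycle public using (cycleArcs)

  EvenSubgraph : Subset size → Set
  EvenSubgraph E =
    Σ[ cs ∈ List Cycle ]
      AllPairs (λ c d → Disjoint (cycleArcs c) (cycleArcs d)) cs ×
      (∀ a → a ∈ E ⇔ Any (λ c → a List.∈ cycleArcs c) cs)

  -- D / E: vertices linked by arcs of E are identified, the arcs of E deleted.
  contract : Subset size → Multidigraph
  contract E = record
    { vertices = Eq.setoid (ArcIn (_∈ E))
    ; Arc      = Σ[ a ∈ Arc ] a ∉ E
    ; src      = λ (a , _) → src a
    ; tgt      = λ (a , _) → tgt a
    }

{-# OPTIONS --safe #-}

-- An even subgraph E makes D / E strongly connected only if it meets every
-- directed cut; in particular it uses exactly two of the three arcs at a source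
-- or sink of degree 3.
--
-- In K₃,₃ with one side consisting of two sources and a sink (or the reverse), E
-- therefore uses two arcs at each vertex of the other side as well, even after a
-- vertex of that side has been replaced by a larger fragment.  Hence K₃,₃ minus a
-- vertex can be substituted for a vertex of degree 3 that is neither source nor
-- sink, to forbid that E avoids this vertex.
--
-- Let the Petersen graph have outer cycle 0 1 2 3 4, spokes i (5 + i) and inner
-- cycle 5 7 9 6 8.  Exactly two of its perfect matchings contain the spoke 05,
-- namely 05 16 27 38 49 and 05 12 34 68 79.  Orient it so that both are directed
-- cuts, 5 is a source and 1 and 4 are sinks, and substitute K₃,₃ minus a vertex for
-- 2, 3, 6 and 9.  If E meets the star of 0 but avoids 05, then E uses two arcs at
-- every vertex, so the complement of E is one of the two matchings, and E misses a
-- directed cut.  Hence E contains 05.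
--
-- Delete 0 from three such graphs and substitute the results for one side of
-- K₃,₃, with the three copies of 05 meeting at a vertex of the other side: E would
-- contain all three arcs there.

module Submission where

open import Defs
open import Algebra.Bundles using (CommutativeRing)
open import Data.Bool.Base using (Bool; true; false; not; _xor_; T; if_then_else_)
open import Data.Bool.ListAction using (or; any)
open import Data.Bool.Properties as Bool
  using (xor-same; xor-comm; xor-assoc; xor-∧-commutativeRing; T-≡)
open import Data.Empty using (⊥)
open import Data.Fin.Base as Fin using (Fin; toℕ)
open import Data.Fin.Induction using (Acc; acc; <-wellFounded)
open import Data.Fin.Properties as Fin using ()
open import Data.Fin.Subset using (Subset; _∈_; _∉_; _-_; ∣_∣)
open import Data.Fin.Subset.Properties
  using (_∈?_; x∈p⇒∣p-x∣<∣p∣; x∈p∧x≢y⇒x∈p-y)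
open import Data.List.Base
  using (List; []; _∷_; _++_; allFin; applyUpTo; concat; concatMap; filterᵇ; foldr;
    length; map; upTo)
import Data.List.Membership.Propositional as List
open import Data.List.Membership.Propositional.Properties
  using (∈-filter⁺; ∈-filter⁻; ∈-allFin)
open import Data.List.Membership.Propositional.Properties.WithK using (unique∧set⇒bag)
import Data.List.Membership.DecPropositional as DecList
open import Data.List.Properties using (≡-dec; filter-≐; map-++; map-∘; map-tabulate)
open import Data.List.Relation.Binary.BagAndSetEquality using (∼bag⇒↭)
open import Data.List.Relation.Binary.Disjoint.Propositional using (Disjoint)
open import Data.List.Relation.Binary.Disjoint.DecPropositional using (disjoint?)
open import Data.List.Relation.Binary.Permutation.Propositional using (_↭_; ↭⇒↭ₛ)
open import Data.List.Relation.Binary.Permutation.Propositional.Properties using (map⁺)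
open import Data.List.Relation.Binary.Permutation.Setoid.Properties using (foldr-commMonoid)
open import Data.List.Relation.Unary.All as All using (All; []; _∷_; all?)
import Data.List.Relation.Unary.All.Properties as All
open import Data.List.Relation.Unary.AllPairs using (AllPairs; []; _∷_; allPairs?)
import Data.List.Relation.Unary.AllPairs.Properties as AllPairs
open import Data.List.Relation.Unary.Any as Any using (Any; here; there; any?)
import Data.List.Relation.Unary.Any.Properties as Any
open import Data.List.Relation.Unary.Unique.Propositional using (Unique)
import Data.List.Relation.Unary.Unique.Propositional.Properties as Unique
open import Data.Maybe.Base using (Maybe; just; nothing)
import Data.Maybe.Relation.Unary.Any as Maybe
open import Data.Nat.Base using (ℕ; suc; _+_; _*_; _≤_; _<_; _<ᵇ_; _≡ᵇ_; s≤s⁻¹)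
open import Data.Nat.DivMod using (_mod_)
open import Data.Nat.Properties as ℕ using (<-≤-trans)
open import Data.Product as Product using (Σ-syntax; ∃-syntax; _×_; _,_; proj₁; proj₂)
open import Data.Product.Properties as Product using ()
open import Data.Sum.Base as Sum using (_⊎_; inj₁; inj₂)
open import Data.Unit.Base using (tt)
open import Data.Vec.Base as Vec using (Vec; fromList; lookup)
open import Data.Vec.Properties as Vec using ([]=⇒lookup; lookup⇒[]=; lookup-map)
import Data.Vec.Relation.Unary.All as VecAll
import Data.Vec.Relation.Unary.All.Properties as VecAll
import Data.Vec.Relation.Unary.AllPairs as VecAllPairs
open import Data.Vec.Relation.Unary.Unique.Propositional.Properties using (lookup-injective)
open import Function.Base using (_∘_; id)
open import Function.Bundles using (mk⇔; Equivalence)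
import Relation.Binary.Construct.Closure.Equivalence as Eq
open import Relation.Binary.Construct.Closure.ReflexiveTransitive using (Star; ε; _◅_)
open import Relation.Binary.PropositionalEquality
open import Relation.Nullary using (Dec; ¬_; yes; no; contradiction)
open import Relation.Nullary.Decidable
  using (True; toWitness; T?; ¬?; _×-dec_; _⊎-dec_; _→-dec_)

-- Parity of lists of truth values.

parity : List Bool → Bool
parity = foldr _xor_ false

parity-↭ : ∀ {bs cs} → bs ↭ cs → parity bs ≡ parity cs
parity-↭ p = foldr-commMonoid (setoid Bool) Xor.+-isCommutativeMonoid (↭⇒↭ₛ p)
  where
  module Xor = CommutativeRing xor-∧-commutativeRing

-- Both sides count, modulo 2, the entries satisfying `p` and `q`.
parity-filterᵇ : ∀ {A : Set} (p q : A → Bool) as →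
  parity (map p (filterᵇ q as)) ≡ parity (map q (filterᵇ p as))
parity-filterᵇ p q []       = refl
parity-filterᵇ p q (a ∷ as) with p a in pa | q a in qa
... | true  | true  rewrite pa | qa = cong not (parity-filterᵇ p q as)
... | true  | false rewrite qa = parity-filterᵇ p q as
... | false | true  rewrite pa = parity-filterᵇ p q as
... | false | false = parity-filterᵇ p q as

xor-telescope : ∀ x y z → (x xor y) xor (y xor z) ≡ x xor z
xor-telescope x y z = trans (xor-assoc x y (y xor z)) (cong (x xor_)
  (trans (sym (xor-assoc y y z)) (cong (_xor z) (xor-same y))))

parity-++ : ∀ bs cs → parity (bs ++ cs) ≡ parity bs xor parity cs
parity-++ []       cs = refl
parity-++ (b ∷ bs) cs =
  trans (cong (b xor_) (parity-++ bs cs)) (sym (xor-assoc b (parity bs) (parity cs)))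

-- A record, so that bs can be inferred from a proof.
record Even (bs : List Bool) : Set where
  constructor even
  field parity-false : parity bs ≡ false

-- Even subgraphs against cuts and directed cuts.

module _ {n : ℕ} (D : Digraph n) where
  open Digraph D

  crosses : (Fin n → Bool) → Arc → Bool
  crosses X a = X (src a) xor X (tgt a)

  boundary : (Fin n → Bool) → List Arc
  boundary X = filterᵇ (crosses X) (allFin size)

  module _ (X : Fin n → Bool) where

    -- Inner vertices cancel, so a closed walk crosses `X` evenly.
    parity-walk : ∀ {u v} (w : Walk D u v) →
      parity (map (crosses X) (arcs D w)) ≡ X u xor X v
    parity-walk {u} [] = sym (xor-same (X u))
    parity-walk {u} {v} (step {v = w} a (inj₁ (refl , refl)) p)
      rewrite parity-walk p = xor-telescope (X u) (X w) (X v)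
    parity-walk {u} {v} (step {v = w} a (inj₂ (refl , refl)) p)
      rewrite parity-walk p | xor-comm (X w) (X u) = xor-telescope (X u) (X w) (X v)

    parity-cycles : ∀ (cs : List (Cycle D)) →
      parity (map (crosses X) (concat (map cycleArcs cs))) ≡ false
    parity-cycles []       = refl
    parity-cycles (c ∷ cs)
      rewrite map-++ (crosses X) (cycleArcs c) (concat (map cycleArcs cs))
            | parity-++ (map (crosses X) (cycleArcs c)) (map (crosses X) (concat (map cycleArcs cs)))
            | parity-walk (Cycle.walk c) | parity-cycles cs
            | xor-same (X (Cycle.base c)) = refl

    even-boundary : ∀ {E} → EvenSubgraph D E → Even (map (lookup E) (boundary X))
    even-boundary {E} (cs , disjoint , E⇔cs) = even (trans
      -- Instead of the arcs of `E` in the cut, count the crossings along the cycles that make up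
      -- `E`.
      (parity-filterᵇ (lookup E) (crosses X) (allFin size))
      (trans (parity-↭ (map⁺ (crosses X) arcs↭)) (parity-cycles cs)))
      where
      L : List Arc
      L = concat (map cycleArcs cs)

      L-unique : Unique L
      L-unique = Unique.concat⁺
        (All.map⁺ (All.universal Cycle.distinct-arcs cs))
        (AllPairs.map⁺ disjoint)

      to : ∀ {a} → a List.∈ filterᵇ (lookup E) (allFin size) → a List.∈ L
      to {a} a∈ = Any.concat⁺ (Any.map⁺ (Equivalence.to (E⇔cs a)
        (lookup⇒[]= a E (Equivalence.to T-≡
          (proj₂ (∈-filter⁻ (T? ∘ lookup E) {xs = allFin size} a∈))))))

      from : ∀ {a} → a List.∈ L → a List.∈ filterᵇ (lookup E) (allFin size)
      from {a} a∈ = ∈-filter⁺ (T? ∘ lookup E) (∈-allFin a) (Equivalence.from T-≡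
        ([]=⇒lookup (Equivalence.from (E⇔cs a) (Any.map⁻ (Any.concat⁻ (map cycleArcs cs) a∈)))))

      arcs↭ : filterᵇ (lookup E) (allFin size) ↭ L
      arcs↭ = ∼bag⇒↭ (unique∧set⇒bag
        (Unique.filter⁺ (T? ∘ lookup E) (Unique.allFin⁺ size)) L-unique (mk⇔ to from))

    -- For `true` no arc leaves `X`, as at a sink; for `false` none enters it, as at a source.
    Trapped : Bool → Set
    Trapped b = (∀ a → X (src a) ≡ b → X (tgt a) ≡ b) × (∃[ u ] X u ≡ b) × (∃[ v ] X v ≢ b)

    -- If `E` misses the cut, contraction identifies only vertices on the same side, and no arc
    -- leaves side `b`.
    trapped⇒boundary-met : ∀ {E b} → Trapped b → StronglyConnected (contract D E) →
      T (or (map (lookup E) (boundary X)))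
    trapped⇒boundary-met {E} {b} (closed , (u , u∈) , (v , v∉)) connected
      with any? (_∈? E) (boundary X)
    ... | yes met = Any.any⁺ (lookup E) (Any.map (Equivalence.from T-≡ ∘ []=⇒lookup) met)
    ... | no ¬met = contradiction (stays (connected u v) u∈) v∉
      where
      uncrossed : ∀ a → a ∈ E → X (src a) ≡ X (tgt a)
      uncrossed a a∈E with X (src a) in p | X (tgt a) in q
      ... | true  | true  = refl
      ... | false | false = refl
      ... | true  | false = contradiction
        (Any.map (λ { refl → a∈E }) (∈-filter⁺ (T? ∘ crosses X) (∈-allFin a)
          (subst T (sym (cong₂ _xor_ p q)) _))) ¬met
      ... | false | true = contradiction
        (Any.map (λ { refl → a∈E }) (∈-filter⁺ (T? ∘ crosses X) (∈-allFin a)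
          (subst T (sym (cong₂ _xor_ p q)) _))) ¬met

      linked⇒≡ : ∀ {u v} → Linked D (_∈ E) u v → X u ≡ X v
      linked⇒≡ = Eq.gfold isEquivalence X λ { (a , a∈E , refl , refl) → uncrossed a a∈E }

      stays : ∀ {u v} → Star _ u v → X u ≡ b → X v ≡ b
      stays ε = id
      stays (inj₁ u≈v ◅ s) u∈ = stays s (trans (sym (linked⇒≡ u≈v)) u∈)
      stays (inj₂ ((a , _) , u≈a , a≈v) ◅ s) u∈ =
        stays s (trans (sym (linked⇒≡ a≈v)) (closed a (trans (sym (linked⇒≡ u≈a)) u∈)))

  -- Edge connectivity from disjoint descending routes.

  trace : Fin n → List Arc → Maybe (Fin n)
  trace u []       = just u
  trace u (a ∷ as) with src a Fin.≟ u | tgt a Fin.≟ u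
  ... | yes _ | _     = trace (tgt a) as
  ... | no _  | yes _ = trace (src a) as
  ... | no _  | no _  = nothing

  trace⇒linked : ∀ {P : Arc → Set} {Q : Fin n → Set} u as → All P as → Maybe.Any Q (trace u as) →
    Σ[ v ∈ Fin n ] Q v × Linked D P u v
  trace⇒linked u [] [] (Maybe.just q) = u , q , Eq.reflexive _
  trace⇒linked {P} u (a ∷ as) (pa ∷ pas) q with src a Fin.≟ u | tgt a Fin.≟ u
  ... | yes s≡u | _ =
    let v , qv , l = trace⇒linked (tgt a) as pas q
    in v , qv , Eq.transitive _ (Eq.return (a , pa , s≡u , refl)) l
  ... | no _ | yes t≡u =
    let v , qv , l = trace⇒linked (src a) as pas q
    in v , qv , Eq.transitive _ (Eq.symmetric _ (Eq.return (a , pa , refl , t≡u))) l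
  trace⇒linked u (a ∷ as) (pa ∷ pas) () | no _ | no _

  -- An arc `a` of `F` spoils only one list `p`: lists disjoint from `p` that avoid `F - a` also
  -- avoid `F`.
  avoiding : ∀ (F : Subset size) ps → AllPairs Disjoint ps → ∣ F ∣ < length ps →
    Any (All (_∉ F)) ps
  avoiding F (p ∷ ps) (p# ∷ ps#) F<ps with any? (_∈? F) p
  ... | no ¬met = here (All.¬Any⇒All¬ p ¬met)
  ... | yes met with List.find met
  ...   | a , a∈p , a∈F = there (widen p# (avoiding (F - a) ps ps#
            (<-≤-trans (x∈p⇒∣p-x∣<∣p∣ a∈F) (s≤s⁻¹ F<ps))))
    where
    widen : ∀ {qs} → All (Disjoint p) qs → Any (All (_∉ (F - a))) qs → Any (All (_∉ F)) qs
    widen (p#q ∷ _) (here q∉) = here (All.tabulate λ {b} b∈q b∈F →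
      All.lookup q∉ b∈q (x∈p∧x≢y⇒x∈p-y b∈F λ { refl → p#q (a∈p , b∈q) }))
    widen (_ ∷ p#qs) (there q∉) = there (widen p#qs q∉)

  DisjointDescents : ℕ → Fin n → Set
  DisjointDescents k v = Σ[ ps ∈ List (List Arc) ] k ≤ length ps × AllPairs Disjoint ps ×
    All (λ p → Maybe.Any (Fin._< v) (trace v p)) ps

  -- After fewer than `k` deletions some route at `v` survives and ends at a smaller vertex, so
  -- well-founded descent reaches `r`.
  descents⇒edgeConnected : ∀ {k} (r : Fin n) → 1 < n →
    (∀ v → v ≡ r ⊎ DisjointDescents k v) → EdgeConnected D k
  descents⇒edgeConnected r 1<n descend = 1<n , λ F F<k u v →
    Eq.transitive _ (toRoot F F<k u (<-wellFounded u))
      (Eq.symmetric _ (toRoot F F<k v (<-wellFounded v)))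
    where
    toRoot : ∀ F → ∣ F ∣ < _ → ∀ v → Acc Fin._<_ v → Linked D (_∉ F) v r
    toRoot F F<k v (acc smaller) with descend v
    ... | inj₁ refl = Eq.reflexive _
    ... | inj₂ (ps , k≤ps , ps# , ends) =
      let p∉F , end = All.lookupAny ends (avoiding F ps ps# (<-≤-trans F<k k≤ps))
          w , w<v , v~w = trace⇒linked v _ end p∉F
      in Eq.transitive _ v~w (toRoot F F<k w (smaller w<v))

-- Case analysis at vertices of degree 3.

data TwoOf : Bool → Bool → Bool → Set where
  ftt : TwoOf false true true
  tft : TwoOf true false true
  ttf : TwoOf true true false

data EvenOf : Bool → Bool → Bool → Set where
  fff : EvenOf false false false
  ftt : EvenOf false true true
  tft : EvenOf true false true
  ttf : EvenOf true true false

evenOf : ∀ {x y z} → Even (x ∷ y ∷ z ∷ []) → EvenOf x y z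
evenOf {false} {false} {false} _ = fff
evenOf {false} {true}  {true}  _ = ftt
evenOf {true}  {false} {true}  _ = tft
evenOf {true}  {true}  {false} _ = ttf
evenOf {false} {false} {true}  (even ())
evenOf {false} {true}  {false} (even ())
evenOf {true}  {false} {false} (even ())
evenOf {true}  {true}  {true}  (even ())

twoOf : ∀ {x y z} → Even (x ∷ y ∷ z ∷ []) → T (or (x ∷ y ∷ z ∷ [])) → TwoOf x y z
twoOf e nonzero with evenOf e | nonzero
... | fff | ()
... | ftt | _ = ftt
... | tft | _ = tft
... | ttf | _ = ttf

rotate : ∀ {x y z} → TwoOf x y z → TwoOf y z x
rotate ftt = ttf
rotate tft = ftt
rotate ttf = tft

-- The rows hold six `true` entries, the even columns `y` and `z` at most two each. So column `x`
-- holds an even number, at least two.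
K₃₃ : ∀ {x₁ x₂ x₃ y₁ y₂ y₃ z₁ z₂ z₃} →
  TwoOf x₁ y₁ z₁ → TwoOf x₂ y₂ z₂ → TwoOf x₃ y₃ z₃ →
  EvenOf y₁ y₂ y₃ → EvenOf z₁ z₂ z₃ → TwoOf x₁ x₂ x₃
K₃₃ ftt tft ttf tft ttf = ftt
K₃₃ ftt ttf tft ttf tft = ftt
K₃₃ tft ftt ttf ftt ttf = tft
K₃₃ ttf ftt tft ttf ftt = tft
K₃₃ tft ttf ftt ftt tft = ttf
K₃₃ ttf tft ftt tft ftt = ttf

petersen : ∀ {a₀₅ a₀₁ a₀₄ a₅₇ a₅₈ a₇₂ a₇₉ a₈₃ a₈₆ a₂₁ a₆₁ a₃₄ a₉₄ a₂₃ a₆₉} →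
  TwoOf a₀₅ a₀₁ a₀₄ →
  TwoOf a₀₅ a₅₇ a₅₈ → TwoOf a₀₁ a₂₁ a₆₁ → TwoOf a₀₄ a₃₄ a₉₄ →
  EvenOf a₅₇ a₇₂ a₇₉ → EvenOf a₅₈ a₈₃ a₈₆ →
  TwoOf a₇₂ a₂₁ a₂₃ → TwoOf a₈₃ a₂₃ a₃₄ → TwoOf a₈₆ a₆₁ a₆₉ → TwoOf a₇₉ a₆₉ a₉₄ →
  T (or (a₀₅ ∷ a₇₂ ∷ a₈₃ ∷ a₆₁ ∷ a₉₄ ∷ [])) →
  T (or (a₀₅ ∷ a₇₉ ∷ a₈₆ ∷ a₂₁ ∷ a₃₄ ∷ [])) →
  a₀₅ ≡ true
petersen tft _ _ _ _ _ _ _ _ _ _ _ = refl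
petersen ttf _ _ _ _ _ _ _ _ _ _ _ = refl
-- Without 05 only two patterns fit all vertices. Their complements are the matchings 05 16 27 38 49
-- and 05 12 34 68 79, which are the two cuts required to be met.
petersen ftt ftt ttf ttf tft tft _ _ _ _ () _
petersen ftt ftt tft tft ttf ttf _ _ _ _ _ ()

¬allTrue : ∀ {x y z} → TwoOf x y z → x ≡ true → y ≡ true → z ≡ true → ⊥
¬allTrue ftt () _ _
¬allTrue tft _ () _
¬allTrue ttf _ _ ()

-- The digraph as a table of arcs.

-- Finds the arcs of a cut in one pass over the table, which keeps the evaluation of
-- concrete cuts cheap.
indices : ∀ {A : Set} {n} → (A → Bool) → Vec A n → List (Fin n)
indices p Vec.[]       = []
indices p (x Vec.∷ xs) = if p x then Fin.zero ∷ rest else rest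
  where
  rest : List (Fin _)
  rest = map Fin.suc (indices p xs)

filterᵇ-map : ∀ {A B : Set} (p : B → Bool) (f : A → B) xs →
  filterᵇ p (map f xs) ≡ map f (filterᵇ (p ∘ f) xs)
filterᵇ-map p f []       = refl
filterᵇ-map p f (x ∷ xs) with p (f x)
... | true  = cong (f x ∷_) (filterᵇ-map p f xs)
... | false = filterᵇ-map p f xs

filterᵇ-lookup : ∀ {A : Set} {n} (p : A → Bool) (xs : Vec A n) →
  filterᵇ (p ∘ lookup xs) (allFin n) ≡ indices p xs
filterᵇ-lookup p Vec.[] = refl
filterᵇ-lookup {n = suc n} p (x Vec.∷ xs)
  with tail ← trans
         (cong (filterᵇ (p ∘ lookup (x Vec.∷ xs))) (sym (map-tabulate id Fin.suc)))
         (trans (filterᵇ-map (p ∘ lookup (x Vec.∷ xs)) Fin.suc (allFin n))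
           (cong (map Fin.suc) (filterᵇ-lookup p xs)))
  with p x
... | true  = cong (Fin.zero ∷_) tail
... | false = tail

crossing : (ℕ → Bool) → ℕ × ℕ → Bool
crossing X (u , v) = X u xor X v

within : List ℕ → ℕ → Bool
within X v = any (v ≡ᵇ_) X

-- The substitutes for a vertex with one arc in and two out, and for one with two in
-- and one out.  The arcs of that vertex are attached to b, b + 1 and b + 2, in the
-- order "in, out, out" and "in, in, out".
splitter joiner : ℕ → List (ℕ × ℕ)
splitter b =
  (b + 3 , b) ∷ (b + 4 , b) ∷ (b + 1 , b + 3) ∷ (b + 1 , b + 4) ∷
  (b + 2 , b + 3) ∷ (b + 2 , b + 4) ∷ []
joiner b =
  (b + 3 , b) ∷ (b + 4 , b) ∷ (b + 3 , b + 1) ∷ (b + 4 , b + 1) ∷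
  (b + 2 , b + 3) ∷ (b + 2 , b + 4) ∷ []

-- The vertices 1, 4, 5, 7, 8 of the Petersen graph are numbered 3, 4, 5, 6, 7 and
-- the substitutes for 2, 3, 6, 9 start at 8, 13, 18, 23.  Instead of the Petersen
-- vertex 0, the arcs 01, 04, 05 end at the vertices 0, 1, 2, which all copies share.
fragment : Vec (ℕ × ℕ) 39
fragment = fromList (
  (5 , 2) ∷ (0 , 3) ∷ (1 , 4) ∷
  (5 , 6) ∷ (5 , 7) ∷ (6 , 8) ∷ (6 , 23) ∷ (7 , 13) ∷ (7 , 18) ∷
  (9 , 3) ∷ (19 , 3) ∷ (15 , 4) ∷ (25 , 4) ∷ (10 , 14) ∷ (20 , 24) ∷
  splitter 8 ++ joiner 13 ++ splitter 18 ++ joiner 23)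

inCopy : ℕ → ℕ → ℕ
inCopy i v = if v <ᵇ 3 then v else 25 * i + v

copies : List ℕ
copies = 0 ∷ 1 ∷ 2 ∷ []

-- The construction has 78 vertices; 22 triangles sharing the vertex 0 bring
-- their number to 122.
triangle : ℕ → List (ℕ × ℕ)
triangle k = (0 , x) ∷ (x , 0) ∷ (0 , y) ∷ (y , 0) ∷ (x , y) ∷ []
  where
  x y : ℕ
  x = 78 + 2 * k
  y = 79 + 2 * k

arcTable : Vec (ℕ × ℕ) 227
arcTable = fromList (
  concatMap (λ i → map (Product.map (inCopy i) (inCopy i)) (Vec.toList fragment)) copies ++
  concatMap triangle (upTo 22))

endsTable : Vec (Fin 122 × Fin 122) 227
endsTable = Vec.map (Product.map (_mod 122) (_mod 122)) arcTable

-- All entries are below 122, so reduction loses nothing and later checks can run on natural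
-- numbers.
endsTable-toℕ : ∀ a → Product.map toℕ toℕ (lookup endsTable a) ≡ lookup arcTable a
endsTable-toℕ a = trans (sym (lookup-map a (Product.map toℕ toℕ) endsTable))
  (cong (λ table → lookup table a) (toWitness
    {a? = Vec.≡-dec (Product.≡-dec ℕ._≟_ ℕ._≟_)
      (Vec.map (Product.map toℕ toℕ) endsTable) arcTable} tt))

endsTable-injective : ∀ a b → lookup endsTable a ≡ lookup endsTable b → a ≡ b
endsTable-injective a b eq = lookup-injective
  (toWitness {a? = VecAllPairs.allPairs?
    (λ p q → ¬? (Product.≡-dec ℕ._≟_ ℕ._≟_ p q)) arcTable} tt)
  a b (trans (sym (endsTable-toℕ a)) (trans (cong (Product.map toℕ toℕ) eq) (endsTable-toℕ b)))

D₁₂₂ : Digraph 122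
D₁₂₂ = record
  { size           = 227
  ; ends           = lookup endsTable
  ; ends-injective = endsTable-injective _ _
  ; loopless       = λ a loop → VecAll.lookup⁺
      (toWitness {a? = VecAll.all? (λ (u , v) → ¬? (u ℕ.≟ v)) arcTable} tt) a
      (trans (sym (cong proj₁ (endsTable-toℕ a)))
        (trans (cong toℕ loop) (cong proj₂ (endsTable-toℕ a))))
  }

open Digraph D₁₂₂ hiding (ends)

-- Three disjoint routes at every vertex but the root.

arcInCopy : ℕ → ℕ → Arc
arcInCopy i k = (39 * i + k) mod 227

-- Entry v lists, by numbers of arcs, three arc-disjoint routes from vertex 3 + v to
-- smaller vertices.
fragmentRoutes : List (List (List ℕ))
fragmentRoutes =
  ((1 ∷ []) ∷ (9 ∷ 17 ∷ 15 ∷ 5 ∷ 3 ∷ 0 ∷ []) ∷ (10 ∷ 29 ∷ 31 ∷ 14 ∷ 35 ∷ 37 ∷ 12 ∷ 2 ∷ []) ∷ []) ∷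
  ((2 ∷ []) ∷ (11 ∷ 25 ∷ 23 ∷ 13 ∷ 19 ∷ 17 ∷ 9 ∷ []) ∷ (12 ∷ 37 ∷ 33 ∷ 6 ∷ 3 ∷ 0 ∷ []) ∷ []) ∷
  ((0 ∷ []) ∷ (3 ∷ 5 ∷ 15 ∷ 17 ∷ 9 ∷ []) ∷ (4 ∷ 8 ∷ 27 ∷ 29 ∷ 10 ∷ []) ∷ []) ∷
  ((3 ∷ []) ∷ (5 ∷ 15 ∷ 17 ∷ 9 ∷ []) ∷ (6 ∷ 33 ∷ 37 ∷ 12 ∷ []) ∷ []) ∷
  ((4 ∷ []) ∷ (7 ∷ 21 ∷ 25 ∷ 11 ∷ []) ∷ (8 ∷ 27 ∷ 29 ∷ 10 ∷ []) ∷ []) ∷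
  ((5 ∷ []) ∷ (15 ∷ 17 ∷ 9 ∷ []) ∷ (16 ∷ 20 ∷ 13 ∷ 23 ∷ 25 ∷ 11 ∷ []) ∷ []) ∷
  ((9 ∷ []) ∷ (17 ∷ 15 ∷ []) ∷ (18 ∷ 16 ∷ []) ∷ []) ∷
  ((13 ∷ 23 ∷ 25 ∷ 11 ∷ []) ∷ (19 ∷ 15 ∷ []) ∷ (20 ∷ 16 ∷ []) ∷ []) ∷
  ((15 ∷ []) ∷ (17 ∷ []) ∷ (19 ∷ []) ∷ []) ∷
  ((16 ∷ []) ∷ (18 ∷ []) ∷ (20 ∷ []) ∷ []) ∷
  ((7 ∷ []) ∷ (21 ∷ 25 ∷ 11 ∷ []) ∷ (22 ∷ 24 ∷ 13 ∷ []) ∷ []) ∷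
  ((13 ∷ []) ∷ (23 ∷ 21 ∷ []) ∷ (24 ∷ 22 ∷ []) ∷ []) ∷
  ((11 ∷ []) ∷ (25 ∷ 21 ∷ []) ∷ (26 ∷ 22 ∷ []) ∷ []) ∷
  ((21 ∷ []) ∷ (23 ∷ []) ∷ (25 ∷ []) ∷ []) ∷
  ((22 ∷ []) ∷ (24 ∷ []) ∷ (26 ∷ []) ∷ []) ∷
  ((8 ∷ []) ∷ (27 ∷ 29 ∷ 10 ∷ []) ∷ (28 ∷ 32 ∷ 14 ∷ 35 ∷ 37 ∷ 12 ∷ []) ∷ []) ∷
  ((10 ∷ []) ∷ (29 ∷ 27 ∷ []) ∷ (30 ∷ 28 ∷ []) ∷ []) ∷
  ((14 ∷ 35 ∷ 37 ∷ 12 ∷ []) ∷ (31 ∷ 27 ∷ []) ∷ (32 ∷ 28 ∷ []) ∷ []) ∷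
  ((27 ∷ []) ∷ (29 ∷ []) ∷ (31 ∷ []) ∷ []) ∷
  ((28 ∷ []) ∷ (30 ∷ []) ∷ (32 ∷ []) ∷ []) ∷
  ((6 ∷ []) ∷ (33 ∷ 37 ∷ 12 ∷ []) ∷ (34 ∷ 36 ∷ 14 ∷ []) ∷ []) ∷
  ((14 ∷ []) ∷ (35 ∷ 33 ∷ []) ∷ (36 ∷ 34 ∷ []) ∷ []) ∷
  ((12 ∷ []) ∷ (37 ∷ 33 ∷ []) ∷ (38 ∷ 34 ∷ []) ∷ []) ∷
  ((33 ∷ []) ∷ (35 ∷ []) ∷ (37 ∷ []) ∷ []) ∷
  ((34 ∷ []) ∷ (36 ∷ []) ∷ (38 ∷ []) ∷ []) ∷ []

-- The copies use the arcs 0 to 116, each triangle five more.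
triangleRoutes : ℕ → List (List (List Arc))
triangleRoutes k = map (map (map λ j → (117 + 5 * k + j) mod 227))
  (((0 ∷ []) ∷ (1 ∷ []) ∷ (4 ∷ 2 ∷ []) ∷ []) ∷
   ((2 ∷ []) ∷ (3 ∷ []) ∷ (4 ∷ 0 ∷ []) ∷ []) ∷ [])

routes : Vec (List (List Arc)) 122
routes = fromList (
  [] ∷
  -- Vertices 1 and 2 reach the root 0 by one route through each copy.
  map (throughCopy (2 ∷ 11 ∷ 25 ∷ 23 ∷ 13 ∷ 19 ∷ 17 ∷ 9 ∷ 1 ∷ [])) copies ∷
  map (throughCopy (0 ∷ 3 ∷ 5 ∷ 15 ∷ 17 ∷ 9 ∷ 1 ∷ [])) copies ∷
  concatMap (λ i → map (map (λ p → throughCopy p i)) fragmentRoutes) copies ++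
  concatMap triangleRoutes (upTo 22))
  where
  throughCopy : List ℕ → ℕ → List Arc
  throughCopy p i = map (arcInCopy i) p

D₁₂₂-edgeConnected : EdgeConnected D₁₂₂ 3
D₁₂₂-edgeConnected = descents⇒edgeConnected D₁₂₂ (0 mod 122) (toWitness {a? = 1 ℕ.<? 122} tt)
  λ v → Sum.map₂ (lookup routes v ,_) (toWitness {a? = Fin.all? descends?} tt v)
  where
  descends? : ∀ v → Dec (v ≡ 0 mod 122 ⊎ _)
  descends? v = (v Fin.≟ 0 mod 122) ⊎-dec
    (3 ℕ.≤? length (lookup routes v) ×-dec
     allPairs? (disjoint? Fin._≟_) (lookup routes v) ×-dec
     all? (λ p → Maybe.dec (Fin._<? v) (trace D₁₂₂ v p)) (lookup routes v))

-- Cuts evaluated on the table.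

boundary-D₁₂₂ : ∀ X → boundary D₁₂₂ (X ∘ toℕ) ≡ indices (crossing X) arcTable
boundary-D₁₂₂ X = trans
  (filter-≐ (T? ∘ crosses D₁₂₂ (X ∘ toℕ)) (T? ∘ crossing X ∘ lookup arcTable)
    ((λ {a} → subst T (crosses≡ a)) , (λ {a} → subst T (sym (crosses≡ a)))) (allFin 227))
  (filterᵇ-lookup (crossing X) arcTable)
  where
  crosses≡ : ∀ a → crosses D₁₂₂ (X ∘ toℕ) a ≡ crossing X (lookup arcTable a)
  crosses≡ a = cong (crossing X) (endsTable-toℕ a)

Closed : (ℕ → Bool) → Bool → Set
Closed X b =
  VecAll.All (λ (u , v) → X u ≡ b → X v ≡ b) arcTable ×
  (∃[ u ] X (toℕ {122} u) ≡ b) × (∃[ v ] X (toℕ {122} v) ≢ b)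

closed? : ∀ X b → Dec (Closed X b)
closed? X b =
  VecAll.all? (λ (u , v) → (X u Bool.≟ b) →-dec (X v Bool.≟ b)) arcTable ×-dec
  Fin.any? (λ u → X (toℕ u) Bool.≟ b) ×-dec Fin.any? (λ v → ¬? (X (toℕ v) Bool.≟ b))

closed⇒trapped : ∀ {X b} → Closed X b → Trapped D₁₂₂ (X ∘ toℕ) b
closed⇒trapped {X} {b} (closed , inside , outside) = stays , inside , outside
  where
  stays : ∀ a → X (toℕ (src a)) ≡ b → X (toℕ (tgt a)) ≡ b
  stays a s∈ = trans (cong (X ∘ proj₂) (endsTable-toℕ a))
    (VecAll.lookup⁺ closed a (trans (sym (cong (X ∘ proj₁) (endsTable-toℕ a))) s∈))

-- The forced arc of one fragment.

fragmentBoundary : List ℕ → List ℕ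
fragmentBoundary X = map toℕ (indices (crossing (within X)) fragment)

-- The last two come from the Petersen cycles 5 7 9 6 8 and 5 7 2 3 8, whose boundaries are the two
-- matchings containing 05.
wholeFragment innerCycle₁ innerCycle₂ : List ℕ
wholeFragment = applyUpTo (3 +_) 25
innerCycle₁   = 5 ∷ 6 ∷ 7 ∷ applyUpTo (18 +_) 10
innerCycle₂   = 5 ∷ 6 ∷ 7 ∷ applyUpTo (8 +_) 10

fragmentCuts fragmentSources fragmentSinks : List (List ℕ)
fragmentCuts    = wholeFragment ∷ innerCycle₁ ∷ innerCycle₂ ∷ map (_∷ []) wholeFragment
fragmentSources = innerCycle₁ ∷ innerCycle₂ ∷ map (_∷ []) (5 ∷ 9 ∷ 10 ∷ 15 ∷ 19 ∷ 20 ∷ 25 ∷ [])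
fragmentSinks   = map (_∷ []) (3 ∷ 4 ∷ 8 ∷ 13 ∷ 14 ∷ 18 ∷ 23 ∷ 24 ∷ [])

open DecList (≡-dec ℕ._≟_) using () renaming (_∈_ to _∈ˡ_; _∈?_ to _∈ˡ?_)

-- `f k` stands for membership of arc `k` in `E`, so that one argument serves all copies.
module _ (f : ℕ → Bool)
  (even-cut : ∀ {X} → X ∈ˡ fragmentCuts → Even (map f (fragmentBoundary X)))
  (source-met : ∀ {X} → X ∈ˡ fragmentSources → T (or (map f (fragmentBoundary X))))
  (sink-met : ∀ {X} → X ∈ˡ fragmentSinks → T (or (map f (fragmentBoundary X))))
  where

  private
    cut : ∀ X {_ : True (X ∈ˡ? fragmentCuts)} → Even (map f (fragmentBoundary X))
    cut X {X∈} = even-cut (toWitness X∈)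

    source : ∀ X {_ : True (X ∈ˡ? fragmentSources)} → T (or (map f (fragmentBoundary X)))
    source X {X∈} = source-met (toWitness X∈)

    sink : ∀ X {_ : True (X ∈ˡ? fragmentSinks)} → T (or (map f (fragmentBoundary X)))
    sink X {X∈} = sink-met (toWitness X∈)

  fragment-even : EvenOf (f 0) (f 1) (f 2)
  fragment-even = evenOf (cut wholeFragment)

  -- `K₃₃` turns the substitutes back into the Petersen vertices 2, 3, 6, 9, each with exactly two
  -- arcs in `E`.
  fragment-forces : TwoOf (f 0) (f 1) (f 2) → f 0 ≡ true
  fragment-forces two₀ = petersen two₀
    (twoOf (cut (5 ∷ [])) (source (5 ∷ [])))
    (twoOf (cut (3 ∷ [])) (sink (3 ∷ [])))
    (twoOf (cut (4 ∷ [])) (sink (4 ∷ [])))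
    (evenOf (cut (6 ∷ [])))
    (evenOf (cut (7 ∷ [])))
    (K₃₃ (twoOf (cut (8 ∷ [])) (sink (8 ∷ []))) (twoOf (cut (9 ∷ [])) (source (9 ∷ [])))
      (twoOf (cut (10 ∷ [])) (source (10 ∷ [])))
      (evenOf (cut (11 ∷ []))) (evenOf (cut (12 ∷ []))))
    (K₃₃ (twoOf (cut (13 ∷ [])) (sink (13 ∷ []))) (twoOf (cut (14 ∷ [])) (sink (14 ∷ [])))
      (twoOf (cut (15 ∷ [])) (source (15 ∷ [])))
      (evenOf (cut (16 ∷ []))) (evenOf (cut (17 ∷ []))))
    (K₃₃ (twoOf (cut (18 ∷ [])) (sink (18 ∷ []))) (twoOf (cut (19 ∷ [])) (source (19 ∷ [])))
      (twoOf (cut (20 ∷ [])) (source (20 ∷ [])))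
      (evenOf (cut (21 ∷ []))) (evenOf (cut (22 ∷ []))))
    (K₃₃ (twoOf (cut (23 ∷ [])) (sink (23 ∷ []))) (twoOf (cut (24 ∷ [])) (sink (24 ∷ [])))
      (twoOf (cut (25 ∷ [])) (source (25 ∷ [])))
      (evenOf (cut (26 ∷ []))) (evenOf (cut (27 ∷ []))))
    (source innerCycle₁)
    (source innerCycle₂)

-- Fragment cuts inside the whole digraph.

copyOf : ℕ → List ℕ → ℕ → Bool
copyOf i X = within (map (inCopy i) X)

LiftsTo : ℕ → List ℕ → Set
LiftsTo i X =
  indices (crossing (copyOf i X)) arcTable ≡ map (arcInCopy i) (fragmentBoundary X)

-- These sets avoid the shared vertices 0, 1, 2, so only arcs of their own copy cross them.
fragmentCuts-lift : All (λ i → All (LiftsTo i) fragmentCuts) copies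
fragmentCuts-lift = toWitness
  {a? = all? (λ i → all? (λ X → ≡-dec Fin._≟_ _ _) fragmentCuts) copies} tt

fragmentSources-closed : All (λ i → All (λ X → Closed (copyOf i X) false) fragmentSources) copies
fragmentSources-closed = toWitness
  {a? = all? (λ i → all? (λ X → closed? (copyOf i X) false) fragmentSources) copies} tt

fragmentSinks-closed : All (λ i → All (λ X → Closed (copyOf i X) true) fragmentSinks) copies
fragmentSinks-closed = toWitness
  {a? = all? (λ i → all? (λ X → closed? (copyOf i X) true) fragmentSinks) copies} tt

-- The contradiction between the three copies.

module _ {E : Subset 227} (E-even : EvenSubgraph D₁₂₂ E)
  (connected : StronglyConnected (contract D₁₂₂ E)) where

  even-indices : ∀ X → Even (map (lookup E) (indices (crossing X) arcTable))
  even-indices X = subst (Even ∘ map (lookup E)) (boundary-D₁₂₂ X)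
    (even-boundary D₁₂₂ (X ∘ toℕ) E-even)

  closed⇒met : ∀ X {b} → Closed X b → T (or (map (lookup E) (indices (crossing X) arcTable)))
  closed⇒met X closed = subst (T ∘ or ∘ map (lookup E)) (boundary-D₁₂₂ X)
    (trapped⇒boundary-met D₁₂₂ (X ∘ toℕ) (closed⇒trapped closed) connected)

  module Copy {i : ℕ} (i∈ : i List.∈ copies) where

    inE : ℕ → Bool
    inE k = lookup E (arcInCopy i k)

    transfer : ∀ {X} (P : List Bool → Set) → X ∈ˡ fragmentCuts →
      P (map (lookup E) (indices (crossing (copyOf i X)) arcTable)) →
      P (map inE (fragmentBoundary X))
    transfer {X} P X∈ = subst P (trans
      (cong (map (lookup E)) (All.lookup (All.lookup fragmentCuts-lift i∈) X∈))
      (sym (map-∘ (fragmentBoundary X))))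

    even-cut : ∀ {X} → X ∈ˡ fragmentCuts → Even (map inE (fragmentBoundary X))
    even-cut {X} X∈ = transfer Even X∈ (even-indices (copyOf i X))

    source-met : ∀ {X} → X ∈ˡ fragmentSources → T (or (map inE (fragmentBoundary X)))
    source-met {X} X∈ = transfer (T ∘ or) (All.lookup sources⊆cuts X∈)
      (closed⇒met (copyOf i X) (All.lookup (All.lookup fragmentSources-closed i∈) X∈))
      where
      sources⊆cuts : All (_∈ˡ fragmentCuts) fragmentSources
      sources⊆cuts = toWitness {a? = all? (_∈ˡ? fragmentCuts) fragmentSources} tt

    sink-met : ∀ {X} → X ∈ˡ fragmentSinks → T (or (map inE (fragmentBoundary X)))
    sink-met {X} X∈ = transfer (T ∘ or) (All.lookup sinks⊆cuts X∈)
      (closed⇒met (copyOf i X) (All.lookup (All.lookup fragmentSinks-closed i∈) X∈))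
      where
      sinks⊆cuts : All (_∈ˡ fragmentCuts) fragmentSinks
      sinks⊆cuts = toWitness {a? = all? (_∈ˡ? fragmentCuts) fragmentSinks} tt

    copy-even : EvenOf (inE 0) (inE 1) (inE 2)
    copy-even = fragment-even inE even-cut source-met sink-met

    copy-forces : TwoOf (inE 0) (inE 1) (inE 2) → inE 0 ≡ true
    copy-forces = fragment-forces inE even-cut source-met sink-met

  module C₀ = Copy (here refl)
  module C₁ = Copy (there (here refl))
  module C₂ = Copy (there (there (here refl)))

  directed : ∀ X b {_ : True (closed? X b)} {x y z} →
    indices (crossing X) arcTable ≡ x ∷ y ∷ z ∷ [] →
    TwoOf (lookup E x) (lookup E y) (lookup E z)
  directed X b {closed} eq = twoOf
    (subst (Even ∘ map (lookup E)) eq (even-indices X))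
    (subst (T ∘ or ∘ map (lookup E)) eq (closed⇒met X (toWitness closed)))

  -- The rows of the outer `K₃₃` are the vertices 2, 0, 1 and the columns are the copies; `rotate`
  -- brings each copy to the first column.
  contradictory : ⊥
  contradictory = ¬allTrue sink₂
    (C₀.copy-forces (K₃₃ sink₂ source₀ source₁ C₁.copy-even C₂.copy-even))
    (C₁.copy-forces (K₃₃ (rotate sink₂) (rotate source₀) (rotate source₁)
      C₂.copy-even C₀.copy-even))
    (C₂.copy-forces (K₃₃ (rotate (rotate sink₂)) (rotate (rotate source₀))
      (rotate (rotate source₁)) C₀.copy-even C₁.copy-even))
    where
    -- The triangles have arcs into 0, so they are taken together with 0 to obtain a source.
    source₀ : TwoOf (C₀.inE 1) (C₁.inE 1) (C₂.inE 1)
    source₀ = directed (within (0 ∷ applyUpTo (78 +_) 44)) false refl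

    source₁ : TwoOf (C₀.inE 2) (C₁.inE 2) (C₂.inE 2)
    source₁ = directed (within (1 ∷ [])) false refl

    sink₂ : TwoOf (C₀.inE 0) (C₁.inE 0) (C₂.inE 0)
    sink₂ = directed (within (2 ∷ [])) true refl

proposition3 : Σ[ D ∈ Digraph 122 ]
    (EdgeConnected D 3 ×
    (∀ (E : Subset (Digraph.size D)) → EvenSubgraph D E → ¬ StronglyConnected (contract D E)))
proposition3 = D₁₂₂ , D₁₂₂-edgeConnected , λ E → contradictory
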